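{- Let $A$ be an ITL formula and $w$ a state formula, both interpreted over non-empty finite intervals. Let $Cl^{w}(A)$ and $Cl^{\neg w}(A)$ be a fixed $w$-closed pair for $A$ (as defined in the context), with fixed associated equivalences. Then $A$ is equivalent to a formula of the syntax $$w\wedge(\mathsf R^{w,w}\vee\mathsf R^{w,\neg w})\ \vee\ \neg w\wedge(\mathsf R^{\neg w,w}\vee\mathsf R^{\neg w,\neg w}),$$ where, for $\varepsilon,\varepsilon'$ ranging over optional negations, the syntactic classes are given by the BNFs $$\begin{array}{l} \mathsf L^{\varepsilon w,\varepsilon w}::=(C\wedge\Box\varepsilon w);\mathit{skip}\ \mid\ \mathsf L^{\varepsilon w,\varepsilon w}\vee\mathsf L^{\varepsilon w,\varepsilon w}\ \mid\ \mathsf L^{\varepsilon w,\varepsilon' w};\mathsf L^{\overline{\varepsilon'}w,\varepsilon w}\\ \mathsf L^{\varepsilon w,\overline\varepsilon w}::=\mathsf L^{\varepsilon w,\overline\varepsilon w}\vee\mathsf L^{\varepsilon w,\overline\varepsilon w}\ \mid\ \mathsf L^{\varepsilon w,\varepsilon' w};\mathsf L^{\overline{\varepsilon'}w,\overline\varepsilon w}\ \mid\ (\mathsf L^{\varepsilon w,\overline\varepsilon w})^*\\ \mathsf R^{\varepsilon w,\varepsilon w}::=B\wedge\Box\varepsilon w\ \mid\ \mathsf R^{\varepsilon w,\varepsilon w}\vee\mathsf R^{\varepsilon w,\varepsilon w}\ \mid\ \mathsf L^{\varepsilon w,\varepsilon' w};\mathsf R^{\overline{\varepsilon'}w,\varepsilon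 w}\\ \mathsf R^{\varepsilon w,\overline\varepsilon w}::=\mathsf R^{\varepsilon w,\overline\varepsilon w}\vee\mathsf R^{\varepsilon w,\overline\varepsilon w}\ \mid\ \mathsf L^{\varepsilon w,\varepsilon' w};\mathsf R^{\overline{\varepsilon'}w,\overline\varepsilon w} \end{array}$$ in which $B$ (in the BNF for $\mathsf R^{\varepsilon w,\varepsilon w}$) ranges over $Cl^{\varepsilon w}(A)$ and $C$ (in the BNF for $\mathsf L^{\varepsilon w,\varepsilon w}$) ranges over the formulas $B_k^{\varepsilon w}$ that appear in the associated equivalences for formulas from $Cl^{\varepsilon w}(A)$.
   Context: ITL formulas over a finite vocabulary $V$ of propositional variables: $A::=\bot\mid p\mid A\supset A\mid\bigcirc A\mid A;A\mid A^*$; $\top,\neg,\wedge,\vee,\equiv$ are defined as usual. A state formula is a formula built from $\bot$, variables and $\supset$ only. With $\Sigma=\mathcal P(V)$, formulas are evaluated at intervals $\sigma=\sigma^0\ldots\sigma^m\in\Sigma^+$: $\sigma\not\models\bot$; $\sigma\models p$ iff $p\in\sigma^0$; $\supset$ is classical; $\sigma\models\bigcirc A$ iff $m\ge1$ and $\sigma^1\ldots\sigma^m\models A$; $\sigma\models A;B$ iff $\sigma^0\ldots\sigma^k\models A$ and $\sigma^k\ldots\sigma^m\models B$ for some $k\in\{0,\ldots,m\}$; $\sigma\models A^*$ iff $m=0$ or there are $0=k_0<\cdots<k_N=m$ with $\sigma^{k_{n-1}}\ldots\sigma^{k_n}\models A$ for $n=1,\ldots,N$. $\models A$ means $\sigma\models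 A$ for all $\sigma\in\Sigma^+$; $A$ and $B$ are equivalent if $\models A\equiv B$. Abbreviations: $\mathit{empty}=\neg\bigcirc\top$, $\mathit{skip}=\bigcirc\mathit{empty}$, $\Diamond A=\top;A$, $\Box A=\neg\Diamond\neg A$ (in all suffix subintervals). Chop binds more strongly than $\wedge$ unless parentheses indicate otherwise, and $\wedge$ more strongly than $\vee$. An optional negation $\varepsilon$ is either $\neg$ or nothing; $\overline\varepsilon$ denotes the other one. A $w$-closed pair for $A$ is a pair of finite sets of ITL formulas $Cl^w(A),Cl^{\neg w}(A)$ such that $A\wedge w\in Cl^w(A)$, $A\wedge\neg w\in Cl^{\neg w}(A)$ and, for each optional negation $\varepsilon$ and each $B\in Cl^{\varepsilon w}(A)$, there are $K\ge1$, ITL formulas $B_1^{\varepsilon w},\ldots,B_K^{\varepsilon w}$ forming a full system relative to $\Box\varepsilon w$ (i.e. $\models\Box\varepsilon w\supset\bigvee_kB_k^{\varepsilon w}$ and $\models\neg(B_{k_1}^{\varepsilon w}\wedge B_{k_2}^{\varepsilon w}\wedge\Box\varepsilon w)$ for $k_1\ne k_2$), and formulas $B_1^{\overline\varepsilon w,\prime},\ldots,B_K^{\overline\varepsilon w,\prime}\in Cl^{\overline\varepsilon w}(A)$ such that $$\models B\wedge\varepsilon w\equiv (B\wedge\Box\varepsilon w)\vee\bigvee_{k=1}^K\Big((B_k^{\varepsilon w}\wedge\Box\varepsilon w);\mathit{skip};(B_k^{\overline\varepsilon w,\prime}\wedge\overline\varepsilon w)\Big),$$ $$\models B\wedge\varepsilon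 w\equiv \varepsilon w\wedge(\Box\varepsilon w\supset B)\wedge\bigwedge_{k=1}^K\neg\Big((B_k^{\varepsilon w}\wedge\Box\varepsilon w);\mathit{skip};(\neg B_k^{\overline\varepsilon w,\prime}\wedge\overline\varepsilon w)\Big).$$ These are the associated equivalences (one choice of the $B_k^{\varepsilon w},B_k^{\overline\varepsilon w,\prime}$ is fixed for each $B$). Such pairs exist for every $A$ and $w$. -}

module Defs where

open import Data.Empty using (⊥)
open import Data.Fin using (Fin; zero; suc; fromℕ; inject₁)
open import Data.Fin.Subset using (Subset) renaming (_∈_ to _∈ˢ_)
open import Data.List using (List; []; _∷_; length; take)
open import Data.List.Membership.Propositional using (_∈_)
open import Data.List.NonEmpty using (List⁺; _∷_; head; tail)
open import Data.Nat using (ℕ; zero; suc; _∸_; _≤_; _<_; _≥_)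
open import Data.Product using (_×_; Σ-syntax; ∃-syntax)
open import Data.Sum using (_⊎_)
open import Data.Vec.Functional using (Vector; foldr)
open import Relation.Binary.PropositionalEquality using (_≡_; _≢_)

infix  26 _*
infix  25 ○_
infixl 24 _⨾_
infixr 21 _⊃_

-- The vocabulary is V = Fin n.
data Formula (n : ℕ) : Set where
  ⊥ᶠ  : Formula n
  var : Fin n → Formula n
  _⊃_ : Formula n → Formula n → Formula n
  ○_  : Formula n → Formula n
  _⨾_ : Formula n → Formula n → Formula n
  _*  : Formula n → Formula n

data StateFormula {n : ℕ} : Formula n → Set where
  ⊥ᶠ  : StateFormula ⊥ᶠ
  var : ∀ p → StateFormula (var p)
  _⊃_ : ∀ {A B} → StateFormula A → StateFormula B → StateFormula (A ⊃ B)

module _ {n : ℕ} where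

  infix  25 ¬ᶠ_ □_ ◇_
  infixr 23 _∧_
  infixr 22 _∨_
  infix  20 _⟺_

  ¬ᶠ_ : Formula n → Formula n
  ¬ᶠ A = A ⊃ ⊥ᶠ

  ⊤ᶠ : Formula n
  ⊤ᶠ = ¬ᶠ ⊥ᶠ

  _∨_ _∧_ _⟺_ : Formula n → Formula n → Formula n
  A ∨ B = ¬ᶠ A ⊃ B
  A ∧ B = ¬ᶠ (A ⊃ ¬ᶠ B)
  A ⟺ B = (A ⊃ B) ∧ (B ⊃ A)

  ⋁ ⋀ : ∀ {K} → Vector (Formula n) K → Formula n
  ⋁ = foldr _∨_ ⊥ᶠ
  ⋀ = foldr _∧_ ⊤ᶠ

  empty skip : Formula n
  empty = ¬ᶠ (○ ⊤ᶠ)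
  skip  = ○ empty

  ◇_ □_ : Formula n → Formula n
  ◇ A = ⊤ᶠ ⨾ A
  □ A = ¬ᶠ (◇ (¬ᶠ A))

Interval : ℕ → Set
Interval n = List⁺ (Subset n)

module _ {n : ℕ} where

  infix 4 _⊨_ ⊨_

  -- The m of σ = σ⁰…σᵐ, one less than the number of states.
  last : Interval n → ℕ
  last σ = length (tail σ)

  -- prefix k σ = σ⁰…σᵏ and suffix k σ = σᵏ…σᵐ, meaningful for k ≤ m.
  prefix suffix : ℕ → Interval n → Interval n
  prefix k (s ∷ ss) = s ∷ take k ss

  suffix zero    σ            = σ
  suffix (suc k) (s ∷ [])     = s ∷ []
  suffix (suc k) (s ∷ t ∷ ss) = suffix k (t ∷ ss)

  -- σⁱ…σʲ, meaningful for i ≤ j ≤ m.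
  _[_⋯_] : Interval n → ℕ → ℕ → Interval n
  σ [ i ⋯ j ] = prefix (j ∸ i) (suffix i σ)

  _⊨_ : Interval n → Formula n → Set
  σ ⊨ ⊥ᶠ    = ⊥
  σ ⊨ var p = p ∈ˢ head σ
  σ ⊨ A ⊃ B = σ ⊨ A → σ ⊨ B
  σ ⊨ ○ A   = last σ ≥ 1 × suffix 1 σ ⊨ A
  σ ⊨ A ⨾ B = ∃[ k ] k ≤ last σ × prefix k σ ⊨ A × suffix k σ ⊨ B
  σ ⊨ A *   = last σ ≡ 0 ⊎
    (∃[ N ] Σ[ k ∈ (Fin (suc N) → ℕ) ]
      k zero ≡ 0 × k (fromℕ N) ≡ last σ ×
      (∀ (i : Fin N) → k (inject₁ i) < k (suc i)) ×
      (∀ (i : Fin N) → σ [ k (inject₁ i) ⋯ k (suc i) ] ⊨ A))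

  ⊨_ : Formula n → Set
  ⊨ A = ∀ σ → σ ⊨ A

  Equivalent : Formula n → Formula n → Set
  Equivalent A B = ⊨ A ⟺ B

  record FullSystem {K : ℕ} (D : Formula n) (Bs : Vector (Formula n) K) : Set where
    field
      covers   : ⊨ D ⊃ ⋁ Bs
      disjoint : ∀ {k₁ k₂} → k₁ ≢ k₂ → ⊨ ¬ᶠ (Bs k₁ ∧ Bs k₂ ∧ D)

data OptNeg : Set where
  none neg : OptNeg

infix 30 _∙_

_∙_ : ∀ {n} → OptNeg → Formula n → Formula n
none ∙ A = A
neg  ∙ A = ¬ᶠ A

other : OptNeg → OptNeg
other none = neg
other neg  = none

-- Cl none and Cl neg are the two sets of the pair.  The chosen K, Bₖ and Bₖ′
-- are functions of ε and B alone, so that there is a single choice for each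
-- B; their values at B ∉ Cl ε are unconstrained and never used.
record ClosedPair {n : ℕ} (w A : Formula n) : Set where
  field
    Cl   : OptNeg → List (Formula n)
    A∈Cl : ∀ ε → A ∧ ε ∙ w ∈ Cl ε

    K    : OptNeg → Formula n → ℕ
    here : ∀ ε B → Vector (Formula n) (K ε B)
    next : ∀ ε B → Vector (Formula n) (K ε B)

    K≥1     : ∀ ε {B} → B ∈ Cl ε → K ε B ≥ 1
    full    : ∀ ε {B} → B ∈ Cl ε → FullSystem (□ ε ∙ w) (here ε B)
    next∈Cl : ∀ ε {B} → B ∈ Cl ε → ∀ k → next ε B k ∈ Cl (other ε)

    equiv-∨ : ∀ ε {B} → B ∈ Cl ε →
      Equivalent (B ∧ ε ∙ w)
        ((B ∧ □ ε ∙ w) ∨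
         ⋁ λ k → (here ε B k ∧ □ ε ∙ w) ⨾ skip ⨾ (next ε B k ∧ other ε ∙ w))

    equiv-∧ : ∀ ε {B} → B ∈ Cl ε →
      Equivalent (B ∧ ε ∙ w)
        (ε ∙ w ∧ (□ ε ∙ w ⊃ B) ∧
         ⋀ λ k → ¬ᶠ ((here ε B k ∧ □ ε ∙ w) ⨾ skip ⨾ (¬ᶠ next ε B k ∧ other ε ∙ w)))

module Syntax {n : ℕ} {w A : Formula n} (P : ClosedPair w A) where
  open ClosedPair P

  -- 𝖫 ε δ F says that F belongs to the class L^{εw,δw}.  The alternatives
  -- shared by the cases δ = ε and δ = ε̄ are given once, for arbitrary δ.
  data 𝖫 : OptNeg → OptNeg → Formula n → Set where
    base : ∀ {ε B} → B ∈ Cl ε → ∀ k → 𝖫 ε ε ((here ε B k ∧ □ ε ∙ w) ⨾ skip)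
    or   : ∀ {ε δ F G} → 𝖫 ε δ F → 𝖫 ε δ G → 𝖫 ε δ (F ∨ G)
    chop : ∀ {ε ε′ δ F G} → 𝖫 ε ε′ F → 𝖫 (other ε′) δ G → 𝖫 ε δ (F ⨾ G)
    star : ∀ {ε F} → 𝖫 ε (other ε) F → 𝖫 ε (other ε) (F *)

  data 𝖱 : OptNeg → OptNeg → Formula n → Set where
    base : ∀ {ε B} → B ∈ Cl ε → 𝖱 ε ε (B ∧ □ ε ∙ w)
    or   : ∀ {ε δ F G} → 𝖱 ε δ F → 𝖱 ε δ G → 𝖱 ε δ (F ∨ G)
    chop : ∀ {ε ε′ δ F G} → 𝖫 ε ε′ F → 𝖱 (other ε′) δ G → 𝖱 ε δ (F ⨾ G)

  data NormalForm : Formula n → Set where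
    normalForm : ∀ {F₁ F₂ F₃ F₄} →
      𝖱 none none F₁ → 𝖱 none neg F₂ → 𝖱 neg none F₃ → 𝖱 neg neg F₄ →
      NormalForm ((w ∧ (F₁ ∨ F₂)) ∨ (¬ᶠ w ∧ (F₃ ∨ F₄)))

{-# OPTIONS --safe #-}

-- Read each B ∧ εw with B ∈ Cl ε as a state of a finite automaton.  The
-- equivalences equiv-∨ say that these formulas satisfy a system of right-linear
-- equations whose coefficients ((Bₖ ∧ □εw) ; skip) belong to 𝖫 ε ε and whose
-- constant terms B ∧ □εw belong to 𝖱 ε ε.  Every transition changes the sign of
-- w, so a cycle through a state of sign ε is labelled in 𝖫 ε ε̄, exactly where
-- the grammar permits the star, and Kleene's elimination of states stays inside
-- the grammar.  Arden's lemma applies as every label takes at least one step.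
--
-- Since ∨ and ∧ are encoded by negation, everything is proved up to ¬¬, which
-- suffices because the required equivalence is itself a negation.
module Submission where

open import Data.Empty using (⊥-elim)
open import Data.Fin using (Fin; zero; suc; fromℕ; inject₁; fromℕ<)
import Data.Fin.Properties as Fin
open import Data.List using (List; []; _∷_; _++_; take; map; lookup; length; allFin)
open import Data.List.Membership.Propositional using (_∈_)
open import Data.List.Membership.Propositional.Properties
  using (∈-lookup; ∈-allFin; ∈-map⁺; ∈-++⁺ˡ; ∈-++⁺ʳ)
open import Data.List.NonEmpty using (_∷_)
open import Data.List.Properties using (length-take; take-take; take-[])
open import Data.List.Relation.Unary.Any as Any using (index)
open import Data.List.Relation.Unary.Any.Properties using (lookup-index)
open import Data.Maybe using (Maybe; just; nothing)
open import Data.Nat using (ℕ; zero; suc; _+_; _∸_; _≤_; _<_; _≥_; z≤n; s≤s)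
open import Data.Nat.Properties
open import Data.Product using (_×_; _,_; proj₁; proj₂; ∃-syntax; Σ-syntax; map₂)
open import Data.Product.Properties using (≡-dec)
open import Data.Sum using (inj₁; inj₂; [_,_]′)
open import Data.Vec.Functional using (Vector; foldr)
open import Effect.Monad using (RawMonad)
open import Function using (_∘_; id)
open import Level using (0ℓ)
open import Relation.Binary.Definitions using (DecidableEquality)
open import Relation.Binary.PropositionalEquality
open import Relation.Nullary using (¬_; yes; no; contradiction)
open import Relation.Nullary.Decidable using (¬¬-excluded-middle)
open import Relation.Nullary.Negation using (¬¬-Monad)
open import Relation.Unary using (Pred; ∅; _∪_; _∩_)
open import Defs

open RawMonad (¬¬-Monad {a = 0ℓ}) using (pure; _>>=_; _<$>_)

module _ {n : ℕ} where

  -- Intervals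

  last-prefix : ∀ {k} (σ : Interval n) → k ≤ last σ → last (prefix k σ) ≡ k
  last-prefix {k} (s ∷ ss) k≤ = trans (length-take k ss) (m≤n⇒m⊓n≡m k≤)

  last-suffix : ∀ k (σ : Interval n) → last (suffix k σ) ≡ last σ ∸ k
  last-suffix zero    σ            = refl
  last-suffix (suc k) (s ∷ [])     = refl
  last-suffix (suc k) (s ∷ t ∷ ss) = last-suffix k (t ∷ ss)

  suffix-suffix : ∀ i j (σ : Interval n) → suffix j (suffix i σ) ≡ suffix (i + j) σ
  suffix-suffix zero    j       σ            = refl
  suffix-suffix (suc i) zero    (s ∷ [])     = refl
  suffix-suffix (suc i) (suc j) (s ∷ [])     = refl
  suffix-suffix (suc i) j       (s ∷ t ∷ ss) = suffix-suffix i j (t ∷ ss)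

  suffix-suffix-∸ : ∀ {i j} (σ : Interval n) → i ≤ j → suffix (j ∸ i) (suffix i σ) ≡ suffix j σ
  suffix-suffix-∸ {i} σ i≤j = trans (suffix-suffix i _ σ) (cong (λ k → suffix k σ) (m+[n∸m]≡n i≤j))

  prefix-prefix : ∀ {j k} (σ : Interval n) → j ≤ k → prefix j (prefix k σ) ≡ prefix j σ
  prefix-prefix {j} {k} (s ∷ ss) j≤k =
    cong (s ∷_) (trans (take-take j k ss) (cong (λ i → take i ss) (m≤n⇒m⊓n≡m j≤k)))

  suffix-prefix : ∀ {i k} (σ : Interval n) → i ≤ k → suffix i (prefix k σ) ≡ prefix (k ∸ i) (suffix i σ)
  suffix-prefix         σ            z≤n       = refl
  suffix-prefix {i} {k} (s ∷ [])     (s≤s _)   = cong (s ∷_) (sym (take-[] (k ∸ i)))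
  suffix-prefix         (s ∷ t ∷ ss) (s≤s i≤k) = suffix-prefix (t ∷ ss) i≤k

  -- Languages up to ¬¬

  Language : Set₁
  Language = Pred (Interval n) 0ℓ

  infix  4 _⊑_
  infixr 7 _⨟_

  ⟦_⟧ : Formula n → Language
  ⟦ F ⟧ σ = σ ⊨ F

  _⊑_ : Language → Language → Set
  P ⊑ Q = ∀ σ → P σ → ¬ ¬ Q σ

  -- Follows the clause for chop, so that `⟦ F ⨾ G ⟧` is `⟦ F ⟧ ⨟ ⟦ G ⟧` by computation.
  _⨟_ : Language → Language → Language
  (P ⨟ Q) σ = ∃[ k ] k ≤ last σ × P (prefix k σ) × Q (suffix k σ)

  Guarded : Language → Set
  Guarded P = P ⊑ λ σ → last σ ≥ 1

  ⨟-monoˡ : ∀ {P P′} Q → P ⊑ P′ → P ⨟ Q ⊑ P′ ⨟ Q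
  ⨟-monoˡ Q P⊑P′ σ (k , k≤ , p , q) = (λ p′ → k , k≤ , p′ , q) <$> P⊑P′ (prefix k σ) p

  ⨟-monoʳ : ∀ P {Q Q′} → Q ⊑ Q′ → P ⨟ Q ⊑ P ⨟ Q′
  ⨟-monoʳ P Q⊑Q′ σ (k , k≤ , p , q) = (λ q′ → k , k≤ , p , q′) <$> Q⊑Q′ (suffix k σ) q

  ⨟-assocʳ : ∀ P Q R → (P ⨟ Q) ⨟ R ⊑ P ⨟ (Q ⨟ R)
  ⨟-assocʳ P Q R σ (k , k≤ , (j , j≤ , p , q) , r) = pure
    ( j , ≤-trans j≤k k≤ , subst P (prefix-prefix σ j≤k) p
    , k ∸ j , subst (k ∸ j ≤_) (sym (last-suffix j σ)) (∸-monoˡ-≤ j k≤)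
    , subst Q (suffix-prefix σ j≤k) q , subst R (sym (suffix-suffix-∸ σ j≤k)) r )
    where
    j≤k = subst (j ≤_) (last-prefix σ k≤) j≤

  ⨟-assocˡ : ∀ P Q R → P ⨟ (Q ⨟ R) ⊑ (P ⨟ Q) ⨟ R
  ⨟-assocˡ P Q R σ (j , j≤ , p , k , k≤ , q , r) = pure
    ( j + k , j+k≤ , (j , subst (j ≤_) (sym (last-prefix σ j+k≤)) (m≤m+n j k)
    , subst P (sym (prefix-prefix σ (m≤m+n j k))) p
    , subst Q (sym (trans (suffix-prefix σ (m≤m+n j k)) (cong (λ i → prefix i (suffix j σ)) (m+n∸m≡n j k)))) q)
    , subst R (suffix-suffix j k σ) r )
    where
    j+k≤ = subst (j + k ≤_) (m+[n∸m]≡n j≤) (+-monoʳ-≤ j (subst (k ≤_) (last-suffix j σ) k≤))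

  ⨟-guardedʳ : ∀ P Q → Guarded Q → Guarded (P ⨟ Q)
  ⨟-guardedʳ P Q guarded σ (k , _ , _ , q) =
    (λ 1≤ → ≤-trans (subst (1 ≤_) (last-suffix k σ) 1≤) (m∸n≤m _ k)) <$> guarded _ q

  -- Connectives

  ∧-intro : ∀ (A B : Formula n) σ → σ ⊨ A → σ ⊨ B → σ ⊨ A ∧ B
  ∧-intro A B σ a b f = f a b

  ∧-elim : ∀ (A B : Formula n) → ⟦ A ∧ B ⟧ ⊑ ⟦ A ⟧ ∩ ⟦ B ⟧
  ∧-elim A B σ ab f = ab λ a b → f (a , b)

  ∨-introˡ : ∀ (A B : Formula n) σ → σ ⊨ A → σ ⊨ A ∨ B
  ∨-introˡ A B σ a ¬a = ⊥-elim (¬a a)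

  ∨-introʳ : ∀ (A B : Formula n) σ → σ ⊨ B → σ ⊨ A ∨ B
  ∨-introʳ A B σ b _ = b

  ∨-elim : ∀ (A B : Formula n) → ⟦ A ∨ B ⟧ ⊑ ⟦ A ⟧ ∪ ⟦ B ⟧
  ∨-elim A B σ ab f = f (inj₂ (ab (f ∘ inj₁)))

  ⋁-intro : ∀ {K} (Bs : Vector (Formula n) K) k σ → σ ⊨ Bs k → σ ⊨ ⋁ Bs
  ⋁-intro Bs zero    σ b = ∨-introˡ (Bs zero) (⋁ (Bs ∘ suc)) σ b
  ⋁-intro Bs (suc k) σ b = ∨-introʳ (Bs zero) (⋁ (Bs ∘ suc)) σ (⋁-intro (Bs ∘ suc) k σ b)

  ⋁-elim : ∀ {K} (Bs : Vector (Formula n) K) → ⟦ ⋁ Bs ⟧ ⊑ λ σ → ∃[ k ] σ ⊨ Bs k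
  ⋁-elim {suc K} Bs σ b = ∨-elim (Bs zero) (⋁ (Bs ∘ suc)) σ b >>= λ where
    (inj₁ b₀) → pure (zero , b₀)
    (inj₂ b₊) → (λ (k , bₖ) → suc k , bₖ) <$> ⋁-elim (Bs ∘ suc) σ b₊

  □-elim : ∀ (A : Formula n) → ⟦ □ A ⟧ ⊑ ⟦ A ⟧
  □-elim A σ □a ¬a = □a (0 , z≤n , id , ¬a)

  equivalent⇒⊑ : ∀ A B → Equivalent A B → ⟦ A ⟧ ⊑ ⟦ B ⟧
  equivalent⇒⊑ A B A⟺B σ a ¬b = A⟺B σ λ f _ → ¬b (f a)

  equivalent⇒⊒ : ∀ A B → Equivalent A B → ⟦ B ⟧ ⊑ ⟦ A ⟧
  equivalent⇒⊒ A B A⟺B σ b ¬a = A⟺B σ λ _ g → ¬a (g b)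

  -- Double negation can be moved outside an implication: a refutation of `A ⊃ B` refutes `B`, which
  -- contradicts the inclusion as soon as `A` holds.
  ⊑⇒¬¬⊃ : ∀ A B → ⟦ A ⟧ ⊑ ⟦ B ⟧ → ∀ σ → ¬ ¬ σ ⊨ A ⊃ B
  ⊑⇒¬¬⊃ A B A⊑B σ ¬f = ¬f λ a → ⊥-elim (A⊑B σ a λ b → ¬f λ _ → b)

  ⊑-antisym : ∀ A B → ⟦ A ⟧ ⊑ ⟦ B ⟧ → ⟦ B ⟧ ⊑ ⟦ A ⟧ → Equivalent A B
  ⊑-antisym A B A⊑B B⊑A σ h =
    ⊑⇒¬¬⊃ A B A⊑B σ λ f → ⊑⇒¬¬⊃ B A B⊑A σ λ g → h f g

  -- Chop-star

  *-cons : ∀ (A : Formula n) σ k → 1 ≤ k → k ≤ last σ → prefix k σ ⊨ A → suffix k σ ⊨ A * → σ ⊨ A *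
  -- A one-state suffix is read as the decomposition without segments whose sole cut point is 0,
  -- which reduces this case to the next.
  *-cons A σ k 1≤k k≤ a (inj₁ ≡0) =
    *-cons A σ k 1≤k k≤ a (inj₂ (0 , (λ _ → 0) , refl , sym ≡0 , (λ ()) , λ ()))
  *-cons A σ k 1≤k k≤ a (inj₂ (N , κ , κ₀ , κ-last , κ-< , segments)) =
    inj₂ (suc N , κ′ , refl , κ′-last , κ′-< , segments′)
    where
    κ′ : Fin (suc (suc N)) → ℕ
    κ′ zero    = 0
    κ′ (suc i) = k + κ i

    κ′₁ : k + κ zero ≡ k
    κ′₁ = trans (cong (k +_) κ₀) (+-identityʳ k)

    κ′-last : k + κ (fromℕ N) ≡ last σ
    κ′-last = trans (cong (k +_) (trans κ-last (last-suffix k σ))) (m+[n∸m]≡n k≤)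

    κ′-< : ∀ i → κ′ (inject₁ i) < κ′ (suc i)
    κ′-< zero    = subst (1 ≤_) (sym κ′₁) 1≤k
    κ′-< (suc i) = +-monoʳ-< k (κ-< i)

    segments′ : ∀ i → σ [ κ′ (inject₁ i) ⋯ κ′ (suc i) ] ⊨ A
    segments′ zero    = subst (λ j → prefix j σ ⊨ A) (sym κ′₁) a
    segments′ (suc i) = subst (_⊨ A)
      (sym (cong₂ prefix ([m+n]∸[m+o]≡n∸o k (κ (suc i)) (κ (inject₁ i)))
                         (sym (suffix-suffix k (κ (inject₁ i)) σ))))
      (segments i)

  -- Star induction: `P` holds of the suffix at the last cut point and is carried leftwards over one
  -- segment at a time.
  *-induct : ∀ A P → ⟦ A ⟧ ⨟ P ⊑ P → ⟦ A * ⟧ ⨟ P ⊑ P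
  *-induct A P closed σ (m , m≤ , inj₁ ≡0 , p) =
    pure (subst (λ k → P (suffix k σ)) (trans (sym (last-prefix σ m≤)) ≡0) p)
  *-induct A P closed σ (m , m≤ , inj₂ (N , κ , κ₀ , κ-last , κ-< , segments) , p) =
    subst (λ k → ¬ ¬ P (suffix k σ)) κ₀
      (proj₂ (descend N κ κ-< segments (≤-reflexive κ-last′) (subst (λ k → P (suffix k σ)) (sym κ-last′) p)))
    where
    ρ = prefix m σ

    κ-last′ : κ (fromℕ N) ≡ m
    κ-last′ = trans κ-last (last-prefix σ m≤)

    -- The cut points divide `ρ`, whereas `P` concerns suffixes of `σ`; a segment that ends by `m`
    -- is the same in both.
    step : ∀ {i j} → i ≤ j → j ≤ m → ρ [ i ⋯ j ] ⊨ A → P (suffix j σ) → ¬ ¬ P (suffix i σ)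
    step {i} {j} i≤j j≤m a p = closed (suffix i σ)
      ( j ∸ i
      , subst (j ∸ i ≤_) (sym (last-suffix i σ)) (∸-monoˡ-≤ i (≤-trans j≤m m≤))
      , subst (_⊨ A) (trans (cong (prefix (j ∸ i)) (suffix-prefix σ (≤-trans i≤j j≤m)))
                            (prefix-prefix (suffix i σ) (∸-monoˡ-≤ i j≤m))) a
      , subst P (sym (suffix-suffix-∸ σ i≤j)) p )

    -- The bound by `m` travels leftwards together with `P`, as each `step` asks for it at the right
    -- end of its segment.
    descend : ∀ N (κ : Fin (suc N) → ℕ) →
      (∀ i → κ (inject₁ i) < κ (suc i)) → (∀ i → ρ [ κ (inject₁ i) ⋯ κ (suc i) ] ⊨ A) →
      κ (fromℕ N) ≤ m → P (suffix (κ (fromℕ N)) σ) →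
      κ zero ≤ m × ¬ ¬ P (suffix (κ zero) σ)
    descend zero    κ κ-< segments ≤m p = ≤m , pure p
    descend (suc N) κ κ-< segments ≤m p
      with κ₁≤m , ¬¬p ← descend N (κ ∘ suc) (κ-< ∘ suc) (segments ∘ suc) ≤m p =
      ≤-trans (<⇒≤ (κ-< zero)) κ₁≤m , (¬¬p >>= step (<⇒≤ (κ-< zero)) κ₁≤m (segments zero))

  -- Cut points must increase strictly; the guard gives the first segment positive length.
  *-unroll : ∀ A → Guarded ⟦ A ⟧ → ⟦ A ⟧ ⨟ ⟦ A * ⟧ ⊑ ⟦ A * ⟧
  *-unroll A guarded σ (k , k≤ , a , a*) =
    (λ 1≤ → *-cons A σ k (subst (1 ≤_) (last-prefix σ k≤) 1≤) k≤ a a*) <$> guarded _ a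

  -- Each unfolding either reaches `Q` or consumes a prefix of positive length, so induction on a
  -- strict bound for the length of the interval applies.
  arden : ∀ A P Q → Guarded ⟦ A ⟧ → P ⊑ Q ∪ (⟦ A ⟧ ⨟ P) → P ⊑ ⟦ A * ⟧ ⨟ Q
  arden A P Q guarded unfold σ = go (suc (last σ)) σ ≤-refl
    where
    go : ∀ b σ → last σ < b → P σ → ¬ ¬ (⟦ A * ⟧ ⨟ Q) σ
    go (suc b) σ (s≤s σ≤b) p = unfold σ p >>= λ where
      -- Zero iterations: the one-state prefix satisfies `A *` by its first clause.
      (inj₁ q) → pure (0 , z≤n , inj₁ (last-prefix σ z≤n) , q)
      (inj₂ (k , k≤ , a , p′)) → guarded _ a >>= λ 1≤ →
        let 1≤k = subst (1 ≤_) (last-prefix σ k≤) 1≤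
            shorter = subst (_< b) (sym (last-suffix k σ))
              (≤-trans (∸-monoʳ-< 1≤k k≤) σ≤b)
        in go b (suffix k σ) shorter p′ >>= λ q →
           ⨟-assocˡ ⟦ A ⟧ ⟦ A * ⟧ Q σ (k , k≤ , a , q) >>= ⨟-monoˡ Q (*-unroll A guarded) σ

-- Signs of `w`

other-involutive : ∀ ε → other (other ε) ≡ ε
other-involutive none = refl
other-involutive neg  = refl

_≟ᵒ_ : DecidableEquality OptNeg
none ≟ᵒ none = yes refl
none ≟ᵒ neg  = no λ ()
neg  ≟ᵒ none = no λ ()
neg  ≟ᵒ neg  = yes refl

module Elimination {n : ℕ} {w A : Formula n} (P : ClosedPair w A) where
  open ClosedPair P
  open Syntax P

  -- Labels of transitions from a state of sign ε to one of sign ε′: the word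
  -- read so far ends in a block of the sign opposite to ε′.  There is no
  -- formula for the absent transition, whence the Maybe.
  Label : OptNeg → OptNeg → Set
  Label ε ε′ = Maybe (∃[ F ] 𝖫 ε (other ε′) F)

  ⟦_⟧ᴸ : ∀ {ε ε′} → Label ε ε′ → Language
  ⟦ nothing      ⟧ᴸ = ∅
  ⟦ just (F , _) ⟧ᴸ = ⟦ F ⟧

  private variable
    ε ε′ ε″ : OptNeg

  infixr 6 _⊔_
  infixr 7 _·_
  infix  8 _⋆

  _⊔_ : Label ε ε′ → Label ε ε′ → Label ε ε′
  nothing      ⊔ b            = b
  just F       ⊔ nothing      = just F
  just (F , l) ⊔ just (G , m) = just (F ∨ G , or l m)

  _·_ : Label ε ε′ → Label ε′ ε″ → Label ε ε″
  nothing      · b            = nothing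
  just F       · nothing      = nothing
  _·_ {ε′ = ε′} (just (F , l)) (just (G , m)) =
    -- `chop` resumes in the sign opposite to the block that ends `F`, which here is
    -- `other (other ε′)`.
    just (F ⨾ G , chop l (subst (λ e → 𝖫 e _ G) (sym (other-involutive ε′)) m))

  -- The star of an absent loop should denote the one-state intervals, for which the grammar has no
  -- constant. It is left absent, and the zero-fold iteration is added separately wherever the star
  -- is used.
  _⋆ : Label ε ε → Label ε ε
  nothing      ⋆ = nothing
  just (F , l) ⋆ = just (F * , star l)

  ⨆ : ∀ {K} → Vector (Label ε ε′) K → Label ε ε′
  ⨆ = foldr _⊔_ nothing

  ⊔-⊑ : (a b : Label ε ε′) → ⟦ a ⊔ b ⟧ᴸ ⊑ ⟦ a ⟧ᴸ ∪ ⟦ b ⟧ᴸ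
  ⊔-⊑ nothing        b              σ x = pure (inj₂ x)
  ⊔-⊑ (just _)       nothing        σ x = pure (inj₁ x)
  ⊔-⊑ (just (F , _)) (just (G , _)) σ x = ∨-elim F G σ x

  ⊔-upperˡ : (a b : Label ε ε′) → ⟦ a ⟧ᴸ ⊑ ⟦ a ⊔ b ⟧ᴸ
  ⊔-upperˡ (just _)       nothing        σ x = pure x
  ⊔-upperˡ (just (F , _)) (just (G , _)) σ x = pure (∨-introˡ F G σ x)

  ⊔-upperʳ : (a b : Label ε ε′) → ⟦ b ⟧ᴸ ⊑ ⟦ a ⊔ b ⟧ᴸ
  ⊔-upperʳ nothing        b              σ x = pure x
  ⊔-upperʳ (just (F , _)) (just (G , _)) σ x = pure (∨-introʳ F G σ x)

  ⨆-upper : ∀ {K} (as : Vector (Label ε ε′) K) k → ⟦ as k ⟧ᴸ ⊑ ⟦ ⨆ as ⟧ᴸ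
  ⨆-upper as zero    σ x = ⊔-upperˡ (as zero) (⨆ (as ∘ suc)) σ x
  ⨆-upper as (suc k) σ x = ⨆-upper (as ∘ suc) k σ x >>= ⊔-upperʳ (as zero) (⨆ (as ∘ suc)) σ

  ⨆-elim : ∀ {K} (as : Vector (Label ε ε′) K) → ⟦ ⨆ as ⟧ᴸ ⊑ λ σ → ∃[ k ] ⟦ as k ⟧ᴸ σ
  ⨆-elim {K = suc K} as σ x = ⊔-⊑ (as zero) (⨆ (as ∘ suc)) σ x >>= λ where
    (inj₁ y) → pure (zero , y)
    (inj₂ y) → (λ (k , z) → suc k , z) <$> ⨆-elim (as ∘ suc) σ y

  ·-⊑ : (a : Label ε ε′) (b : Label ε′ ε″) → ⟦ a · b ⟧ᴸ ⊑ ⟦ a ⟧ᴸ ⨟ ⟦ b ⟧ᴸ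
  ·-⊑ (just _) (just _) σ x = pure x

  ·-⊒ : (a : Label ε ε′) (b : Label ε′ ε″) → ⟦ a ⟧ᴸ ⨟ ⟦ b ⟧ᴸ ⊑ ⟦ a · b ⟧ᴸ
  ·-⊒ (just _) nothing  σ (_ , _ , _ , ())
  ·-⊒ (just _) (just _) σ x = pure x

  ⋆-induct : ∀ (a : Label ε ε) X → ⟦ a ⟧ᴸ ⨟ X ⊑ X → ⟦ a ⋆ ⟧ᴸ ⨟ X ⊑ X
  ⋆-induct (just (F , _)) X closed = *-induct F X closed

  -- The disjunct `Y` serves the absent loop; a present one includes zero iterations, and `arden`
  -- suffices.
  ⋆-arden : ∀ (a : Label ε ε) X Y → Guarded ⟦ a ⟧ᴸ → X ⊑ Y ∪ (⟦ a ⟧ᴸ ⨟ X) → X ⊑ Y ∪ (⟦ a ⋆ ⟧ᴸ ⨟ Y)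
  ⋆-arden nothing        X Y guarded unfold σ x = unfold σ x >>= λ where
    (inj₁ y) → pure (inj₁ y)
  ⋆-arden (just (F , _)) X Y guarded unfold σ x = inj₂ <$> arden F X Y guarded unfold σ x

  -- One formula for each final sign, as the normal form asks for a member of both classes;
  -- semantically only their union is tracked.
  Remainder : OptNeg → Set
  Remainder ε = ∀ δ → ∃[ F ] 𝖱 ε δ F

  ⟦_⟧ᴿ : Remainder ε → Language
  ⟦ r ⟧ᴿ σ = ∃[ δ ] σ ⊨ proj₁ (r δ)

  infixl 6 _⊕_▹_

  _⊕_▹_ : Remainder ε → Label ε ε′ → Remainder ε′ → Remainder ε
  (r ⊕ nothing      ▹ s) δ = r δ
  _⊕_▹_ {ε′ = ε′} r (just (F , l)) s δ with r δ | s δ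
  ... | G , p | H , q =
    G ∨ F ⨾ H , or p (chop l (subst (λ e → 𝖱 e δ H) (sym (other-involutive ε′)) q))

  ⊕-⊑ : (r : Remainder ε) (a : Label ε ε′) (s : Remainder ε′) →
    ⟦ r ⊕ a ▹ s ⟧ᴿ ⊑ ⟦ r ⟧ᴿ ∪ (⟦ a ⟧ᴸ ⨟ ⟦ s ⟧ᴿ)
  ⊕-⊑ r nothing        s σ (δ , x) = pure (inj₁ (δ , x))
  ⊕-⊑ r (just (F , _)) s σ (δ , x) =
    ∨-elim (proj₁ (r δ)) (F ⨾ proj₁ (s δ)) σ x >>= λ where
      (inj₁ y)                → pure (inj₁ (δ , y))
      (inj₂ (k , k≤ , f , y)) → pure (inj₂ (k , k≤ , f , δ , y))

  ⊕-upperˡ : (r : Remainder ε) (a : Label ε ε′) (s : Remainder ε′) → ⟦ r ⟧ᴿ ⊑ ⟦ r ⊕ a ▹ s ⟧ᴿ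
  ⊕-upperˡ r nothing        s σ (δ , x) = pure (δ , x)
  ⊕-upperˡ r (just (F , _)) s σ (δ , x) =
    pure (δ , ∨-introˡ (proj₁ (r δ)) (F ⨾ proj₁ (s δ)) σ x)

  ⊕-upperʳ : (r : Remainder ε) (a : Label ε ε′) (s : Remainder ε′) → ⟦ a ⟧ᴸ ⨟ ⟦ s ⟧ᴿ ⊑ ⟦ r ⊕ a ▹ s ⟧ᴿ
  ⊕-upperʳ r (just (F , _)) s σ (k , k≤ , f , δ , x) =
    pure (δ , ∨-introʳ (proj₁ (r δ)) (F ⨾ proj₁ (s δ)) σ (k , k≤ , f , x))

  -- States and rows of the automaton

  State : Set
  State = Σ[ ε ∈ OptNeg ] Fin (length (Cl ε))

  sign : State → OptNeg
  sign = proj₁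

  formula : State → Formula n
  formula (ε , b) = lookup (Cl ε) b

  T : State → Formula n
  T i = formula i ∧ sign i ∙ w

  -- States are positions in the lists, so comparing them never compares formulas; a repeated
  -- formula merely yields several states.
  _≟ˢ_ : DecidableEquality State
  _≟ˢ_ = ≡-dec _≟ᵒ_ Fin._≟_

  states : List State
  states = map (none ,_) (allFin _) ++ map (neg ,_) (allFin _)

  ∈-states : ∀ i → i ∈ states
  ∈-states (none , b) = ∈-++⁺ˡ (∈-map⁺ (none ,_) (∈-allFin b))
  ∈-states (neg  , b) = ∈-++⁺ʳ _ (∈-map⁺ (neg ,_) (∈-allFin b))

  -- The right-linear expression rest ∨ ⋁ⱼ (to j ; T j).
  record Row (ε : OptNeg) : Set where
    field
      rest : Remainder ε
      to   : (j : State) → Label ε (sign j)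

  open Row

  -- Here `js` stands for the states not yet eliminated; the row keeps its entries for the others,
  -- but they no longer count.
  Value : List State → Row ε → Language
  Value js r = ⟦ rest r ⟧ᴿ ∪ λ σ → ∃[ j ] j ∈ js × (⟦ to r j ⟧ᴸ ⨟ ⟦ T j ⟧) σ

  -- Ranges over eliminated states as well: their entries are not erased, and they still describe
  -- parts of `X`.
  record Sound (r : Row ε) (X : Language) : Set where
    field
      rest-⊑ : ⟦ rest r ⟧ᴿ ⊑ X
      to-⊑   : ∀ j → ⟦ to r j ⟧ᴸ ⨟ ⟦ T j ⟧ ⊑ X

  open Sound

  GuardedRow : Row ε → Set
  GuardedRow r = ∀ j → Guarded ⟦ to r j ⟧ᴸ

  _⊞_▸_ : Row ε → Label ε ε′ → Row ε′ → Row ε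
  rest (r ⊞ a ▸ s)   = rest r ⊕ a ▹ rest s
  to   (r ⊞ a ▸ s) j = to r j ⊔ a · to s j

  ⊞-sound : ∀ (r : Row ε) (a : Label ε ε′) (s : Row ε′) {X Y} →
    Sound r X → ⟦ a ⟧ᴸ ⨟ Y ⊑ X → Sound s Y → Sound (r ⊞ a ▸ s) X
  rest-⊑ (⊞-sound r a s r⊑X aY⊑X s⊑Y) σ x =
    ⊕-⊑ (rest r) a (rest s) σ x >>= λ where
      (inj₁ y) → rest-⊑ r⊑X σ y
      (inj₂ y) → ⨟-monoʳ ⟦ a ⟧ᴸ (rest-⊑ s⊑Y) σ y >>= aY⊑X σ
  to-⊑ (⊞-sound r a s r⊑X aY⊑X s⊑Y) j σ (k , k≤ , x , t) =
    ⊔-⊑ (to r j) (a · to s j) (prefix k σ) x >>= λ where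
      (inj₁ y) → to-⊑ r⊑X j σ (k , k≤ , y , t)
      (inj₂ y) → ·-⊑ a (to s j) (prefix k σ) y >>= λ z →
        ⨟-assocʳ ⟦ a ⟧ᴸ ⟦ to s j ⟧ᴸ ⟦ T j ⟧ σ (k , k≤ , z , t) >>= λ u →
        ⨟-monoʳ ⟦ a ⟧ᴸ (to-⊑ s⊑Y j) σ u >>= aY⊑X σ

  -- The label `a` may be a star, which admits one-state intervals; the entry of `s` that follows it
  -- supplies the step.
  ⊞-guarded : ∀ (r : Row ε) (a : Label ε ε′) (s : Row ε′) →
    GuardedRow r → GuardedRow s → GuardedRow (r ⊞ a ▸ s)
  ⊞-guarded r a s guarded-r guarded-s j σ x =
    ⊔-⊑ (to r j) (a · to s j) σ x >>= λ where
      (inj₁ y) → guarded-r j σ y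
      (inj₂ y) → ·-⊑ a (to s j) σ y >>= ⨟-guardedʳ ⟦ a ⟧ᴸ ⟦ to s j ⟧ᴸ (guarded-s j) σ

  ⊞-upperˡ : ∀ js (r : Row ε) (a : Label ε ε′) (s : Row ε′) → Value js r ⊑ Value js (r ⊞ a ▸ s)
  ⊞-upperˡ js r a s σ (inj₁ x) = inj₁ <$> ⊕-upperˡ (rest r) a (rest s) σ x
  ⊞-upperˡ js r a s σ (inj₂ (j , j∈ , x)) =
    (λ y → inj₂ (j , j∈ , y)) <$> ⨟-monoˡ ⟦ T j ⟧ (⊔-upperˡ (to r j) (a · to s j)) σ x

  ⊞-upperʳ : ∀ js (r : Row ε) (a : Label ε ε′) (s : Row ε′) →
    ⟦ a ⟧ᴸ ⨟ Value js s ⊑ Value js (r ⊞ a ▸ s)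
  ⊞-upperʳ js r a s σ (k , k≤ , x , inj₁ y) =
    inj₁ <$> ⊕-upperʳ (rest r) a (rest s) σ (k , k≤ , x , y)
  ⊞-upperʳ js r a s σ (k , k≤ , x , inj₂ (j , j∈ , y)) =
    ⨟-assocˡ ⟦ a ⟧ᴸ ⟦ to s j ⟧ᴸ ⟦ T j ⟧ σ (k , k≤ , x , y) >>= λ z →
    ⨟-monoˡ ⟦ T j ⟧ (·-⊒ a (to s j)) σ z >>= λ z →
    (λ y → inj₂ (j , j∈ , y)) <$> ⨟-monoˡ ⟦ T j ⟧ (⊔-upperʳ (to r j) (a · to s j)) σ z

  -- Elimination of states

  System : Set
  System = (i : State) → Row (sign i)

  -- The invariant of the elimination. Once `js` is empty, it identifies each `T i` with the
  -- remainder of its row.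
  record Valid (js : List State) (R : System) : Set where
    field
      sound    : ∀ i → Sound (R i) ⟦ T i ⟧
      guarded  : ∀ i → GuardedRow (R i)
      complete : ∀ i → ⟦ T i ⟧ ⊑ Value js (R i)

  open Valid

  -- Arden's solution, the starred loop followed by `r`, with `r` itself added because the star of
  -- an absent loop is absent.
  closeLoop : (x : State) → Row (sign x) → Row (sign x)
  closeLoop x r = r ⊞ to r x ⋆ ▸ r

  eliminate : State → System → System
  eliminate x R i = R i ⊞ to (R i) x ▸ closeLoop x (R x)

  split-first : ∀ x js (r : Row ε) → Value (x ∷ js) r ⊑ Value js r ∪ (⟦ to r x ⟧ᴸ ⨟ ⟦ T x ⟧)
  split-first x js r σ (inj₁ y)                     = pure (inj₁ (inj₁ y))
  split-first x js r σ (inj₂ (_ , Any.here refl , y))   = pure (inj₂ y)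
  split-first x js r σ (inj₂ (j , Any.there j∈js , y))  = pure (inj₁ (inj₂ (j , j∈js , y)))

  -- Dropping `x` from the list loses only the transition into `x`, and the closed row of `x`, which
  -- is equivalent to `T x`, is substituted there.
  eliminate-valid : ∀ {x js R} → Valid (x ∷ js) R → Valid js (eliminate x R)
  eliminate-valid {x} {js} {R} v = record
    { sound    = λ i → ⊞-sound (R i) (to (R i) x) (closeLoop x (R x)) (sound v i) (to-⊑ (sound v i) x) loop-sound
    ; guarded  = λ i → ⊞-guarded (R i) (to (R i) x) (closeLoop x (R x)) (guarded v i) loop-guarded
    ; complete = λ i σ t → complete v i σ t >>= split-first x js (R i) σ >>= λ where
        (inj₁ y) → ⊞-upperˡ js (R i) (to (R i) x) (closeLoop x (R x)) σ y
        (inj₂ y) → ⨟-monoʳ ⟦ to (R i) x ⟧ᴸ loop-complete σ y >>=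
                   ⊞-upperʳ js (R i) (to (R i) x) (closeLoop x (R x)) σ
    }
    where
    loop : Label (sign x) (sign x)
    loop = to (R x) x

    loop-sound : Sound (closeLoop x (R x)) ⟦ T x ⟧
    loop-sound = ⊞-sound (R x) (loop ⋆) (R x) (sound v x)
      -- `T x` absorbs `loop` on its left, hence also the star of `loop`.
      (⋆-induct loop ⟦ T x ⟧ (to-⊑ (sound v x) x)) (sound v x)

    loop-guarded : GuardedRow (closeLoop x (R x))
    loop-guarded = ⊞-guarded (R x) (loop ⋆) (R x) (guarded v x) (guarded v x)

    loop-complete : ⟦ T x ⟧ ⊑ Value js (closeLoop x (R x))
    loop-complete σ t =
      -- The unknown is `T x`; the constant part is what its row offers besides the loop.
      ⋆-arden loop ⟦ T x ⟧ (Value js (R x)) (guarded v x x)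
        (λ σ t → complete v x σ t >>= split-first x js (R x) σ) σ t >>= λ where
          (inj₁ y) → ⊞-upperˡ js (R x) (loop ⋆) (R x) σ y
          (inj₂ y) → ⊞-upperʳ js (R x) (loop ⋆) (R x) σ y

  solve : ∀ js {R} → Valid js R → ∃[ R′ ] Valid [] R′
  solve []       v = _ , v
  solve (x ∷ js) v = solve js (eliminate-valid v)

  -- The system of the closed pair

  position : ∀ {ε B} → B ∈ Cl ε → State
  position {ε} B∈ = ε , index B∈

  T-position : ∀ {ε B} (B∈ : B ∈ Cl ε) → T (position B∈) ≡ B ∧ ε ∙ w
  T-position {ε} B∈ = cong (_∧ ε ∙ w) (sym (lookup-index B∈))

  stay : ∀ ε → Formula n → Formula n
  stay ε B = B ∧ □ ε ∙ w

  cross : ∀ ε B → Fin (K ε B) → Formula n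
  cross ε B k = stay ε (here ε B k) ⨾ skip

  successor : ∀ {ε B} → B ∈ Cl ε → Fin (K ε B) → State
  successor {ε} B∈ k = position (next∈Cl ε B∈ k)

  stay-⊑ : ∀ ε B → ⟦ stay ε B ⟧ ⊑ ⟦ B ∧ ε ∙ w ⟧
  stay-⊑ ε B σ x = ∧-elim B (□ ε ∙ w) σ x >>= λ (b , □w) →
    ∧-intro B (ε ∙ w) σ b <$> □-elim (ε ∙ w) σ □w

  -- Chop associates to the left, so the summand of `equiv-∨` is already a label followed by a
  -- successor.
  summands : ∀ ε B → Vector (Formula n) (K ε B)
  summands ε B k = cross ε B k ⨾ (next ε B k ∧ other ε ∙ w)

  cross-⊑ : ∀ {ε B} → B ∈ Cl ε → ∀ k → ⟦ summands ε B k ⟧ ⊑ ⟦ B ∧ ε ∙ w ⟧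
  cross-⊑ {ε} {B} B∈ k σ x =
    equivalent⇒⊒ (B ∧ ε ∙ w) (stay ε B ∨ ⋁ (summands ε B)) (equiv-∨ ε B∈) σ
      (∨-introʳ (stay ε B) (⋁ (summands ε B)) σ (⋁-intro (summands ε B) k σ x))

  unfold : ∀ {ε B} → B ∈ Cl ε →
    ⟦ B ∧ ε ∙ w ⟧ ⊑ ⟦ stay ε B ⟧ ∪ λ σ → ∃[ k ] σ ⊨ summands ε B k
  unfold {ε} {B} B∈ σ x =
    equivalent⇒⊑ (B ∧ ε ∙ w) (stay ε B ∨ ⋁ (summands ε B)) (equiv-∨ ε B∈) σ x >>=
    ∨-elim (stay ε B) (⋁ (summands ε B)) σ >>= λ where
      (inj₁ y) → pure (inj₁ y)
      (inj₂ y) → inj₂ <$> ⋁-elim (summands ε B) σ y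

  cross-guarded : ∀ ε B k → Guarded ⟦ cross ε B k ⟧
  cross-guarded ε B k = ⨟-guardedʳ ⟦ stay ε (here ε B k) ⟧ ⟦ skip ⟧ λ σ (1≤ , _) → pure 1≤

  -- The equations give no member of 𝖱 ε ε̄, but the grammar has no formula for
  -- ⊥.  This one is a redundant disjunct, and it exists because K ≥ 1.
  leave : ∀ {ε B} (B∈ : B ∈ Cl ε) → ∃[ F ] 𝖱 ε (other ε) F × ⟦ F ⟧ ⊑ ⟦ B ∧ ε ∙ w ⟧
  leave {ε} {B} B∈ = cross ε B k ⨾ stay (other ε) (next ε B k) ,
    chop (base B∈ k) (base (next∈Cl ε B∈ k)) ,
    λ σ x → ⨟-monoʳ ⟦ cross ε B k ⟧ (stay-⊑ (other ε) (next ε B k)) σ x >>= cross-⊑ B∈ k σ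
    where
    k = fromℕ< (K≥1 ε B∈)

  initialRest : ∀ {ε B} → B ∈ Cl ε → ∀ δ → ∃[ F ] 𝖱 ε δ F × ⟦ F ⟧ ⊑ ⟦ B ∧ ε ∙ w ⟧
  initialRest {none} B∈ none = _ , base B∈ , stay-⊑ none _
  initialRest {none} B∈ neg  = leave B∈
  initialRest {neg}  B∈ none = leave B∈
  initialRest {neg}  B∈ neg  = _ , base B∈ , stay-⊑ neg _

  initialRest-stay : ∀ {ε B} (B∈ : B ∈ Cl ε) → proj₁ (initialRest B∈ ε) ≡ stay ε B
  initialRest-stay {none} B∈ = refl
  initialRest-stay {neg}  B∈ = refl

  crossLabel : ∀ {ε B} → B ∈ Cl ε → Fin (K ε B) → Label ε (other ε)
  crossLabel {ε} {B} B∈ k =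
    just (cross ε B k , subst (λ δ → 𝖫 ε δ (cross ε B k)) (sym (other-involutive ε)) (base B∈ k))

  -- A Kronecker delta: it places a label in the column of `i`.
  only : (i j : State) → Label ε (sign i) → Label ε (sign j)
  only i j a with i ≟ˢ j
  ... | yes refl = a
  ... | no  _    = nothing

  only-elim : ∀ i j (a : Label ε (sign i)) {σ} → ⟦ only i j a ⟧ᴸ σ → i ≡ j × ⟦ a ⟧ᴸ σ
  only-elim i j a x with i ≟ˢ j
  ... | yes refl = refl , x

  only-intro : ∀ i (a : Label ε (sign i)) {σ} → ⟦ a ⟧ᴸ σ → ⟦ only i i a ⟧ᴸ σ
  only-intro i a x with i ≟ˢ i
  ... | yes refl = x
  ... | no  i≢i  = contradiction refl i≢i

  -- Several `k` may share a successor, so each entry joins the labels of all `k` that lead to `j`.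
  initialRow : ∀ {ε B} → B ∈ Cl ε → Row ε
  rest (initialRow B∈) δ = map₂ proj₁ (initialRest B∈ δ)
  to   (initialRow B∈) j = ⨆ λ k → only (successor B∈ k) j (crossLabel B∈ k)

  to-elim : ∀ {ε B} (B∈ : B ∈ Cl ε) j →
    ⟦ to (initialRow B∈) j ⟧ᴸ ⊑ λ σ → ∃[ k ] successor B∈ k ≡ j × ⟦ cross ε B k ⟧ σ
  to-elim B∈ j σ x =
    (λ (k , y) → k , only-elim (successor B∈ k) j (crossLabel B∈ k) y) <$>
    ⨆-elim (λ k → only (successor B∈ k) j (crossLabel B∈ k)) σ x

  initialRow-sound : ∀ {ε B} (B∈ : B ∈ Cl ε) → Sound (initialRow B∈) ⟦ B ∧ ε ∙ w ⟧
  rest-⊑ (initialRow-sound B∈) σ (δ , x) = proj₂ (proj₂ (initialRest B∈ δ)) σ x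
  to-⊑ (initialRow-sound {ε} B∈) j σ (m , m≤ , x , t) = to-elim B∈ j (prefix m σ) x >>= λ where
    (k , refl , y) → cross-⊑ B∈ k σ
      (m , m≤ , y , subst (λ F → suffix m σ ⊨ F) (T-position (next∈Cl ε B∈ k)) t)

  initialRow-guarded : ∀ {ε B} (B∈ : B ∈ Cl ε) → GuardedRow (initialRow B∈)
  initialRow-guarded {ε} {B} B∈ j σ x = to-elim B∈ j σ x >>= λ (k , _ , y) → cross-guarded ε B k σ y

  initialRow-complete : ∀ {ε B} (B∈ : B ∈ Cl ε) → ⟦ B ∧ ε ∙ w ⟧ ⊑ Value states (initialRow B∈)
  initialRow-complete {ε} {B} B∈ σ x = unfold B∈ σ x >>= λ where
    (inj₁ y) → pure (inj₁ (ε , subst (λ F → σ ⊨ F) (sym (initialRest-stay B∈)) y))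
    (inj₂ (k , m , m≤ , y , t)) →
      let j = successor B∈ k in
      (λ z → inj₂ (j , ∈-states j , m , m≤ , z , subst (λ F → suffix m σ ⊨ F) (sym (T-position (next∈Cl ε B∈ k))) t)) <$>
      ⨆-upper (λ k → only (successor B∈ k) j (crossLabel B∈ k)) k (prefix m σ)
        (only-intro j (crossLabel B∈ k) y)

  initial : System
  initial (ε , b) = initialRow (∈-lookup {xs = Cl ε} b)

  initial-valid : Valid states initial
  sound    initial-valid (ε , b) = initialRow-sound (∈-lookup {xs = Cl ε} b)
  guarded  initial-valid (ε , b) = initialRow-guarded (∈-lookup {xs = Cl ε} b)
  complete initial-valid (ε , b) = initialRow-complete (∈-lookup {xs = Cl ε} b)

  solution : ∀ {ε B} → B ∈ Cl ε →
    Σ[ r ∈ Remainder ε ] ⟦ r ⟧ᴿ ⊑ ⟦ B ∧ ε ∙ w ⟧ × ⟦ B ∧ ε ∙ w ⟧ ⊑ ⟦ r ⟧ᴿ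
  solution B∈ with R , v ← solve states initial-valid =
    rest (R i) , subst (λ F → ⟦ rest (R i) ⟧ᴿ ⊑ ⟦ F ⟧) (T-position B∈) (rest-⊑ (sound v i)) ,
    subst (λ F → ⟦ F ⟧ ⊑ ⟦ rest (R i) ⟧ᴿ) (T-position B∈) λ σ t → complete v i σ t >>= λ where
      -- No state is left, so the disjunct for transitions is empty.
      (inj₁ x) → pure x
    where
    i = position B∈

  -- Assembly of the normal form

  branch : (ε : OptNeg) → Remainder ε → Formula n
  branch ε r = ε ∙ w ∧ (proj₁ (r none) ∨ proj₁ (r neg))

  -- The sign occurs twice because the member of `Cl ε` is `A ∧ ε ∙ w`, and a state conjoins `ε ∙ w`
  -- to its formula once more.
  branch-sound : ∀ ε r → ⟦ r ⟧ᴿ ⊑ ⟦ (A ∧ ε ∙ w) ∧ ε ∙ w ⟧ → ⟦ branch ε r ⟧ ⊑ ⟦ A ⟧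
  branch-sound ε r r⊑ σ x =
    ∧-elim (ε ∙ w) (proj₁ (r none) ∨ proj₁ (r neg)) σ x >>= λ (_ , y) →
    ∨-elim (proj₁ (r none)) (proj₁ (r neg)) σ y >>= λ y →
    r⊑ σ ([ none ,_ , neg ,_ ]′ y) >>= λ z →
    ∧-elim (A ∧ ε ∙ w) (ε ∙ w) σ z >>= λ (z , _) →
    proj₁ <$> ∧-elim A (ε ∙ w) σ z

  branch-complete : ∀ ε r → ⟦ (A ∧ ε ∙ w) ∧ ε ∙ w ⟧ ⊑ ⟦ r ⟧ᴿ → ⟦ A ⟧ ∩ ⟦ ε ∙ w ⟧ ⊑ ⟦ branch ε r ⟧
  branch-complete ε r ⊑r σ (a , e) =
    (∧-intro (ε ∙ w) (proj₁ (r none) ∨ proj₁ (r neg)) σ e ∘ λ where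
      (none , x) → ∨-introˡ (proj₁ (r none)) (proj₁ (r neg)) σ x
      (neg  , x) → ∨-introʳ (proj₁ (r none)) (proj₁ (r neg)) σ x) <$>
    ⊑r σ (∧-intro (A ∧ ε ∙ w) (ε ∙ w) σ (∧-intro A (ε ∙ w) σ a e) e)

theorem9 : ∀ (n : ℕ) (A w : Formula n) → StateFormula w → (P : ClosedPair w A) →
    ∃[ F ] Syntax.NormalForm P F × Equivalent A F
theorem9 n A w _ P
  with r₊ , r₊⊑ , ⊑r₊ ← Elimination.solution P (ClosedPair.A∈Cl P none)
     | r₋ , r₋⊑ , ⊑r₋ ← Elimination.solution P (ClosedPair.A∈Cl P neg) =
  F₊ ∨ F₋ ,
  Syntax.normalForm (proj₂ (r₊ none)) (proj₂ (r₊ neg)) (proj₂ (r₋ none)) (proj₂ (r₋ neg)) ,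
  ⊑-antisym A (F₊ ∨ F₋)
    -- Deciding `w` at `σ` is legitimate under double negation and selects the branch.
    (λ σ a → ¬¬-excluded-middle >>= λ where
      (yes x) → ∨-introˡ F₊ F₋ σ <$> branch-complete none r₊ ⊑r₊ σ (a , x)
      (no ¬x) → ∨-introʳ F₊ F₋ σ <$> branch-complete neg r₋ ⊑r₋ σ (a , ¬x))
    (λ σ x → ∨-elim F₊ F₋ σ x >>= λ where
      (inj₁ y) → branch-sound none r₊ r₊⊑ σ y
      (inj₂ y) → branch-sound neg r₋ r₋⊑ σ y)
  where
  open Elimination P
  F₊ = branch none r₊
  F₋ = branch neg r₋
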